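{- Let $k \in \mathbb{N}$, let $M \in \mathbf{J}_k$ and let $\Sigma$ be an alphabet. Then there exists a constant $c \in \mathbb{N}_{>0}$ such that, for every $n \in \mathbb{N}$, any program over $M$ on $\Sigma^n$ is equivalent to a program over $M$ on $\Sigma^n$ of length at most $c \cdot n^{\lceil k/2 \rceil}$. In particular, $\mathcal{P}(\mathbf{J}_k) = \mathcal{P}(\mathbf{J}_k, n^{\lceil k/2 \rceil})$ for all $k \in \mathbb{N}$.
   Context: $\mathbb{N}$ includes $0$; $[n] = \{1, \ldots, n\}$; all alphabets are finite; $n^0 = 1$ for all $n$. Varieties. A variety of monoids is a class of finite monoids closed under submonoids, (finite) Cartesian products and morphic images. A word $u = u_1 \cdots u_m$ is a subword of $w$ if it is a (not necessarily contiguous) subsequence of $w$. For an alphabet $\Sigma$ and $k \in \mathbb{N}$, $\sim_k$ is the congruence on $\Sigma^*$ defined by $u \sim_k v$ iff $u$ and $v$ have the same set of subwords of length at most $k$. $\mathbf{J}_k$ is the inclusion-wise smallest variety of monoids containing all quotients $\Sigma^* / {\sim_k}$ for all alphabets $\Sigma$. Programs. Let $M$ be a finite monoid, $\Sigma$ an alphabet and $n \in \mathbb{N}$. A program $P$ over $M$ on $\Sigma^n$ is a finite sequence of instructions $(i, f)$ with $i \in [n]$ and $f \colon \Sigma \to M$; its length $|P|$ is its number of instructions. On input $w \in \Sigma^n$, instruction $(i, f)$ outputs $f(w_i)$, and $P(w) \in M$ is the product, in order, of the outputs of the instructions. $P$ recognises $L \subseteq \Sigma^n$ if $L = P^{ -1}(F)$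 for some $F \subseteq M$. Two programs over the same monoid on the same $\Sigma^n$ are equivalent if they recognise the same languages. A language $L \subseteq \Sigma^*$ is recognised by a sequence $(P_n)_{n \in \mathbb{N}}$ of programs over one fixed finite monoid $M$ if for each $n$, $P_n$ is a program over $M$ on $\Sigma^n$ recognising $L \cap \Sigma^n$. For a variety of monoids $\mathbf{V}$ and $s \colon \mathbb{N} \to \mathbb{N}$, $\mathcal{P}(\mathbf{V}, s(n))$ is the class of languages (over arbitrary finite alphabets) recognised by some sequence $(P_n)_{n \in \mathbb{N}}$ of programs over some monoid in $\mathbf{V}$ for which there is a real $\alpha > 0$ with $|P_n| \leq \alpha \cdot s(n)$ for all $n \in \mathbb{N}$; and $\mathcal{P}(\mathbf{V}) = \bigcup_{j \in \mathbb{N}} \mathcal{P}(\mathbf{V}, n^j)$. -}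

module Defs where

open import Algebra.Bundles using (Monoid)
import Algebra.Construct.DirectProduct as DirectProduct
import Algebra.Construct.Terminal as Terminal
open import Algebra.Morphism.Structures using (module MonoidMorphisms)
open import Data.Fin.Base using (Fin)
import Data.Fin.Properties as Fin
open import Data.Integer.Base using (+_)
open import Data.List.Base
  using (List; []; _∷_; _++_; length; map; foldr; filter; allFin;
         cartesianProduct; cartesianProductWith)
open import Data.List.Properties using (++-assoc; ++-identityʳ; length-filter)
open import Data.List.Membership.Propositional using (_∈_; lose)
open import Data.List.Membership.Propositional.Properties
  using (∈-allFin; ∈-cartesianProductWith⁺)
open import Data.List.Relation.Binary.Sublist.Heterogeneous.Properties
  using (length-mono-≤)
open import Data.List.Relation.Binary.Sublist.Propositional
  using ([]; _∷_; _∷ʳ_; ⊆-refl; minimum)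
  renaming (_⊆_ to Sublist)
open import Data.List.Relation.Binary.Sublist.Propositional.Properties using (++⁺)
import Data.List.Relation.Binary.Sublist.DecPropositional as DecSublist
import Data.List.Relation.Unary.All as All
open import Data.List.Relation.Unary.All.Properties using (¬All⇒Any¬)
open import Data.List.Relation.Unary.Any as Any using (Any; here; there)
open import Data.List.Relation.Unary.Enumerates.Setoid using (IsEnumeration)
open import Data.List.Relation.Unary.Enumerates.Setoid.Properties
  using (cartesianProduct⁺)
open import Data.Nat.Base using (ℕ; zero; suc; _≤_; _<_; z≤n; s≤s; _^_)
import Data.Nat.Properties as ℕ
open import Data.Product.Base using (_×_; _,_; Σ-syntax; ∃-syntax)
open import Data.Product.Relation.Binary.Pointwise.NonDependent using (×-decidable)
import Data.Rational.Base as ℚ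
open ℚ using (ℚ)
open import Data.Unit.Polymorphic.Base using (tt)
open import Data.Vec.Base using (Vec; lookup; toList)
open import Function.Base using (_∘_)
open import Function.Bundles using (_⇔_; mk⇔; module Equivalence)
open import Function.Definitions using (Surjective)
import Function.Properties.Equivalence as ⇔
open import Level using (Level; 0ℓ; _⊔_) renaming (suc to lsuc)
open import Relation.Binary.Core using (Rel)
open import Relation.Binary.Definitions using (Decidable; _Respects_)
open import Relation.Binary.PropositionalEquality.Core
  using (_≡_; refl; subst)
open import Relation.Binary.Structures using (IsEquivalence)
open import Relation.Nullary.Decidable as Dec
  using (Dec; yes; no; _×-dec_; _→-dec_)
open import Relation.Nullary.Negation.Core using (¬_; contradiction)
open import Relation.Unary using (Pred; _≐_; _⊢_) renaming (_⊆_ to _⊆ᵖ_)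
import Relation.Unary as Unary

private
  variable
    ℓ : Level
    k m n : ℕ

-- Monoids are setoid-based, so that quotients are obtained by changing the
-- equality.  Finiteness means decidable equality together with a list meeting
-- every equivalence class.
record FiniteMonoid : Set₁ where
  field
    monoid : Monoid 0ℓ 0ℓ
  open Monoid monoid public
  field
    _≟_         : Decidable _≈_
    elements    : List Carrier
    enumeration : IsEnumeration setoid elements

-- Submonoids are taken up to isomorphism, as injective morphisms.
record _↪_ (N M : FiniteMonoid) : Set where
  private
    module N = FiniteMonoid N
    module M = FiniteMonoid M
  open MonoidMorphisms N.rawMonoid M.rawMonoid
  field
    to             : N.Carrier → M.Carrier
    isMonomorphism : IsMonoidMonomorphism to

record _↠_ (M N : FiniteMonoid) : Set where
  private
    module M = FiniteMonoid M
    module N = FiniteMonoid N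
  open MonoidMorphisms M.rawMonoid N.rawMonoid
  field
    to             : M.Carrier → N.Carrier
    isHomomorphism : IsMonoidHomomorphism to
    surjective     : Surjective M._≈_ N._≈_ to

𝟙 : FiniteMonoid
𝟙 = record
  { monoid      = Terminal.monoid
  ; _≟_         = λ _ _ → yes tt
  ; elements    = tt ∷ []
  ; enumeration = λ _ → here tt
  }

_⊗_ : FiniteMonoid → FiniteMonoid → FiniteMonoid
M ⊗ N = record
  { monoid      = DirectProduct.monoid M.monoid N.monoid
  ; _≟_         = ×-decidable M._≟_ N._≟_
  ; elements    = cartesianProduct M.elements N.elements
  ; enumeration = cartesianProduct⁺ M.setoid N.setoid M.enumeration N.enumeration
  }
  where
  module M = FiniteMonoid M
  module N = FiniteMonoid N

-- Closure under finite products is closure under the empty and the binary ones.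
record IsVariety (V : Pred FiniteMonoid ℓ) : Set (lsuc 0ℓ ⊔ ℓ) where
  field
    submonoid    : ∀ {M N} → V M → N ↪ M → V N
    emptyProduct : V 𝟙
    product      : ∀ {M N} → V M → V N → V (M ⊗ N)
    image        : ∀ {M N} → V M → M ↠ N → V N

-- The alphabet with m letters is Fin m.
Word : ℕ → Set
Word m = List (Fin m)

_Subword_ : Rel (Word m) 0ℓ
_Subword_ = Sublist

infix 4 _∼[_]_

_∼[_]_ : Word m → ℕ → Word m → Set
u ∼[ k ] v = ∀ x → length x ≤ k → (x Subword u) ⇔ (x Subword v)

∼-isEquivalence : IsEquivalence {A = Word m} (_∼[ k ]_)
∼-isEquivalence = record
  { refl  = λ _ _ → ⇔.refl
  ; sym   = λ p x l → ⇔.sym (p x l)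
  ; trans = λ p q x l → ⇔.trans (p x l) (q x l)
  }

private
  split : ∀ (u : Word m) {v x} → x Subword (u ++ v) →
          ∃[ y ] ∃[ z ] x ≡ y ++ z × y Subword u × z Subword v
  split []      p          = [] , _ , refl , [] , p
  split (a ∷ u) (.a ∷ʳ p)  with split u p
  ... | y , z , refl , q , r = y , z , refl , a ∷ʳ q , r
  split (a ∷ u) (refl ∷ p) with split u p
  ... | y , z , refl , q , r = a ∷ y , z , refl , refl ∷ q , r

  ++-cong-→ : ∀ {u u′ v v′ : Word m} → u ∼[ k ] u′ → v ∼[ k ] v′ →
              ∀ x → length x ≤ k → x Subword (u ++ v) → x Subword (u′ ++ v′)
  ++-cong-→ {u = u} p q x l s with split u s
  ... | y , z , refl , a , b =
    ++⁺ (Equivalence.to (p y (ℕ.≤-trans (length-mono-≤ left) l)) a)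
        (Equivalence.to (q z (ℕ.≤-trans (length-mono-≤ right) l)) b)
    where
    left : y Subword (y ++ z)
    left = subst (_Subword (y ++ z)) (++-identityʳ y) (++⁺ ⊆-refl (minimum z))
    right : z Subword (y ++ z)
    right = ++⁺ (minimum y) ⊆-refl

∼-cong : ∀ {u u′ v v′ : Word m} →
         u ∼[ k ] u′ → v ∼[ k ] v′ → (u ++ v) ∼[ k ] (u′ ++ v′)
∼-cong p q x l = mk⇔
  (++-cong-→ p q x l)
  (++-cong-→ (IsEquivalence.sym ∼-isEquivalence p)
             (IsEquivalence.sym ∼-isEquivalence q) x l)

∼-monoid : ℕ → ℕ → Monoid 0ℓ 0ℓ
∼-monoid k m = record
  { Carrier  = Word m
  ; _≈_      = _∼[ k ]_
  ; _∙_      = _++_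
  ; ε        = []
  ; isMonoid = record
    { isSemigroup = record
      { isMagma = record
        { isEquivalence = ∼-isEquivalence
        ; ∙-cong        = ∼-cong
        }
      ; assoc = λ u v w → E.reflexive (++-assoc u v w)
      }
    ; identity = (λ _ → E.refl) , (λ u → E.reflexive (++-identityʳ u))
    }
  }
  where module E = IsEquivalence (∼-isEquivalence {m = m} {k = k})

wordsUpTo : ∀ m → ℕ → List (Word m)
wordsUpTo m zero    = [] ∷ []
wordsUpTo m (suc k) = [] ∷ cartesianProductWith _∷_ (allFin m) (wordsUpTo m k)

∈-wordsUpTo : ∀ (u : Word m) → length u ≤ k → u ∈ wordsUpTo m k
∈-wordsUpTo {k = zero}  []      _       = here refl
∈-wordsUpTo {k = suc k} []      _       = here refl
∈-wordsUpTo {k = suc k} (a ∷ u) (s≤s l) =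
  there (∈-cartesianProductWith⁺ _∷_ (∈-allFin a) (∈-wordsUpTo u l))

private
  _⊆?_ : (u v : Word m) → Dec (u Subword v)
  _⊆?_ = DecSublist._⊆?_ Fin._≟_

  agreeOn? : (k : ℕ) (u v x : Word m) →
             Dec (length x ≤ k → (x Subword u) ⇔ (x Subword v))
  agreeOn? k u v x = (length x ℕ.≤? k) →-dec
    Dec.map′ (λ (f , g) → mk⇔ f g) (λ e → Equivalence.to e , Equivalence.from e)
      (((x ⊆? u) →-dec (x ⊆? v)) ×-dec ((x ⊆? v) →-dec (x ⊆? u)))

∼-decidable : Decidable {A = Word m} (_∼[ k ]_)
∼-decidable {m = m} {k = k} u v = Dec.map′
  (λ ps x l → All.lookup ps (∈-wordsUpTo x l) l)
  (λ p → All.tabulate (λ {x} _ → p x))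
  (All.all? (agreeOn? k u v) (wordsUpTo m k))

-- Finiteness of the quotient: deleting letters that do not change the class
-- leaves an equivalent word in which every letter contributes a new subword of
-- length at most k, so whose length is at most the number of such words.
private
  module _ {A : Set} {P Q : Pred A 0ℓ} (P? : Unary.Decidable P) (Q? : Unary.Decidable Q)
           (P⊆Q : P ⊆ᵖ Q) where

    filter-≤ : ∀ xs → length (filter P? xs) ≤ length (filter Q? xs)
    filter-≤ [] = z≤n
    filter-≤ (x ∷ xs) with P? x | Q? x
    ... | yes _ | yes _ = s≤s (filter-≤ xs)
    ... | yes p | no ¬q = contradiction (P⊆Q p) ¬q
    ... | no _  | yes _ = ℕ.m≤n⇒m≤1+n (filter-≤ xs)
    ... | no _  | no _  = filter-≤ xs

    filter-< : ∀ {xs} → Any (λ x → ¬ P x × Q x) xs →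
               length (filter P? xs) < length (filter Q? xs)
    filter-< {x ∷ xs} (here (¬p , q)) with P? x | Q? x
    ... | yes p | _     = contradiction p ¬p
    ... | no _  | yes _ = s≤s (filter-≤ xs)
    ... | no _  | no ¬q = contradiction q ¬q
    filter-< {x ∷ xs} (there a) with P? x | Q? x
    ... | yes _ | yes _ = s≤s (filter-< a)
    ... | yes p | no ¬q = contradiction (P⊆Q p) ¬q
    ... | no _  | yes _ = ℕ.m≤n⇒m≤1+n (filter-< a)
    ... | no _  | no _  = filter-< a

  module _ (k m : ℕ) where
    private module E = IsEquivalence (∼-isEquivalence {m = m} {k = k})

    tests : List (Word m)
    tests = wordsUpTo m k

    weight : Word m → ℕ
    weight u = length (filter (_⊆? u) tests)

    weight-< : ∀ a u → ¬ ((a ∷ u) ∼[ k ] u) → weight u < weight (a ∷ u)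
    weight-< a u ≁ = filter-< (_⊆? u) (_⊆? (a ∷ u)) (a ∷ʳ_)
      (Any.map new (¬All⇒Any¬ (agreeOn? k (a ∷ u) u) tests
        (λ ps → ≁ (λ x l → All.lookup ps (∈-wordsUpTo x l) l))))
      where
      new : ∀ {x} → ¬ (length x ≤ k → (x Subword (a ∷ u)) ⇔ (x Subword u)) →
            ¬ (x Subword u) × x Subword (a ∷ u)
      new {x} ¬e with x ⊆? u | x ⊆? (a ∷ u)
      ... | yes p | _     = contradiction (λ _ → mk⇔ (λ _ → p) (a ∷ʳ_)) ¬e
      ... | no ¬p | yes q = ¬p , q
      ... | no _  | no ¬q = contradiction
        (λ _ → mk⇔ (λ q → contradiction q ¬q) (a ∷ʳ_)) ¬e

    reduced : ∀ u → ∃[ r ] u ∼[ k ] r × length r ≤ weight r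
    reduced []      = [] , E.refl , z≤n
    reduced (a ∷ u) with reduced u
    ... | r , u∼r , l with ∼-decidable {k = k} (a ∷ r) r | ∼-cong (E.refl {a ∷ []}) u∼r
    ... | yes e | au∼ar = r , E.trans au∼ar e , l
    ... | no ¬e | au∼ar = a ∷ r , au∼ar , ℕ.≤-<-trans l (weight-< a r ¬e)

    representatives : List (Word m)
    representatives = wordsUpTo m (length tests)

    representatives-complete : IsEnumeration (Monoid.setoid (∼-monoid k m)) representatives
    representatives-complete u with reduced u
    ... | r , u∼r , l = lose
      (∈-wordsUpTo r (ℕ.≤-trans l (length-filter (_⊆? r) tests))) u∼r

_/∼_ : ℕ → ℕ → FiniteMonoid
m /∼ k = record
  { monoid      = ∼-monoid k m
  ; _≟_         = ∼-decidable
  ; elements    = representatives k m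
  ; enumeration = representatives-complete k m
  }

-- The smallest variety containing all quotients, generated inductively.
data J (k : ℕ) : Pred FiniteMonoid (lsuc 0ℓ) where
  quotient     : ∀ m → J k (m /∼ k)
  submonoid    : ∀ {M N} → J k M → N ↪ M → J k N
  emptyProduct : J k 𝟙
  product      : ∀ {M N} → J k M → J k N → J k (M ⊗ N)
  image        : ∀ {M N} → J k M → M ↠ N → J k N

J-isVariety : IsVariety (J k)
J-isVariety = record
  { submonoid    = submonoid
  ; emptyProduct = emptyProduct
  ; product      = product
  ; image        = image
  }

J-smallest : {V : Pred FiniteMonoid ℓ} → IsVariety V →
             (∀ m → V (m /∼ k)) → J k ⊆ᵖ V
J-smallest {k = k} {V = V} isVariety V/∼ = go
  where
  module V = IsVariety isVariety
  go : J k ⊆ᵖ V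
  go (quotient m)    = V/∼ m
  go (submonoid j s) = V.submonoid (go j) s
  go emptyProduct    = V.emptyProduct
  go (product i j)   = V.product (go i) (go j)
  go (image j s)     = V.image (go j) s

record Program (M : FiniteMonoid) (m n : ℕ) : Set where
  constructor program
  open FiniteMonoid M using (Carrier; _∙_; ε)
  field
    instructions : List (Fin n × (Fin m → Carrier))

  ∣_∣ : ℕ
  ∣_∣ = length instructions

  run : Vec (Fin m) n → Carrier
  run w = foldr _∙_ ε (map (λ (i , f) → f (lookup w i)) instructions)

open Program public using (∣_∣; run)

infix 4 _Recognises_

-- Subsets of M are predicates compatible with its equality.
_Recognises_ : ∀ {M} → Program M m n → Pred (Vec (Fin m) n) 0ℓ → Set₁
_Recognises_ {M = M} P L =
  Σ[ F ∈ Pred Carrier 0ℓ ] (F Respects _≈_) × L ≐ (run P ⊢ F)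
  where open FiniteMonoid M using (Carrier; _≈_)

infix 4 _≋_

_≋_ : ∀ {M} → Rel (Program M m n) (lsuc 0ℓ)
P ≋ Q = ∀ L → (P Recognises L) ⇔ (Q Recognises L)

Language : ℕ → Set₁
Language m = Pred (Word m) 0ℓ

slice : Language m → ∀ n → Pred (Vec (Fin m) n) 0ℓ
slice L n = toList ⊢ L

infix 4 _≤_·_

-- ∣P∣ ≤ α · s for a rational α; there are no reals in the library, and allowing
-- real α > 0 in the growth bound below would give the same classes.
_≤_·_ : ℕ → ℚ → ℕ → Set
l ≤ α · s = (+ l ℚ./ 1) ℚ.≤ α ℚ.* (+ s ℚ./ 1)

𝒫[_,_] : Pred FiniteMonoid ℓ → (ℕ → ℕ) → Pred (Language m) (lsuc 0ℓ ⊔ ℓ)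
𝒫[_,_] {m = m} V s L =
  Σ[ M ∈ FiniteMonoid ] V M ×
  Σ[ P ∈ ((n : ℕ) → Program M m n) ] (∀ n → P n Recognises slice L n) ×
  Σ[ α ∈ ℚ ] (ℚ.0ℚ ℚ.< α) × (∀ n → ∣ P n ∣ ≤ α · s n)

𝒫 : Pred FiniteMonoid ℓ → Pred (Language m) (lsuc 0ℓ ⊔ ℓ)
𝒫 V L = Σ[ j ∈ ℕ ] 𝒫[ V , _^ j ] L

{-# OPTIONS --safe #-}

-- If M is in J_k, then products in M do not distinguish
-- ∼_k-equivalent sequences of factors.  So a program may be replaced by any
-- ∼_k-equivalent word over the alphabet of instructions, which has O(n) letters,
-- and it remains to see that a word over N letters is ∼_k-equivalent to one of
-- length O(N^h), where h = ⌈k/2⌉.  A letter a can be deleted from p a s as soon as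
-- p a ∼_h p and a s ∼_h s: in an occurrence of a subword x a y of length at most
-- 2h, one of x a and a y has length at most h, and can avoid this a.  A letter that
-- must be kept brings a new subword of length at most h to the prefix or to the
-- suffix, which happens O(N^h) times.
module Submission where

open import Defs
import Algebra.Morphism.Construct.DirectProduct as DirectProduct
open import Algebra.Morphism.Structures using (module MonoidMorphisms)
open import Data.Fin.Base using (Fin; combine; remQuot; funToFin; finToFun)
open import Data.Fin.Properties
  using (remQuot-combine; finToFun-funToFin) renaming (_≟_ to _≟ᶠ_)
import Data.Integer.Base as ℤ
import Data.Integer.Properties as ℤ
open import Data.List.Base
  using (List; []; _∷_; [_]; _++_; length; map; foldr; concatMap; filter; lookup; allFin;
         cartesianProductWith)
open import Data.List.Membership.Propositional using (_∈_)
open import Data.List.Membership.Propositional.Properties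
  using (∈-filter⁺; ∈-filter⁻)
open import Data.List.Properties
  using (++-assoc; length-++; length-filter; length-map; map-∘; length-tabulate)
open import Data.List.Relation.Binary.Pointwise using (Pointwise-≡⇒≡)
import Data.List.Relation.Binary.Sublist.DecPropositional as DecSublist
open import Data.List.Relation.Binary.Sublist.Heterogeneous.Properties
  using (length-mono-≤; toPointwise)
open import Data.List.Relation.Binary.Sublist.Propositional
  using ([]; _∷_; _∷ʳ_; ⊆-refl; ⊆-trans; minimum) renaming (_⊆_ to Sublist)
open import Data.List.Relation.Binary.Sublist.Propositional.Properties
  using (++⁺; ++⁺ʳ; filter⁺)
open import Data.List.Relation.Unary.Any using (index)
open import Data.List.Relation.Unary.Any.Properties using (lookup-index)
open import Data.Nat.Base
  using (ℕ; zero; suc; _+_; _≤_; _<_; _>_; _*_; _^_; ⌈_/2⌉; z≤n; s≤s)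
open import Data.Nat.Properties
open import Data.Product.Base using (_×_; _,_; Σ-syntax; ∃-syntax; proj₁; proj₂)
import Data.Rational.Base as ℚ
import Data.Rational.Properties as ℚ
open import Data.Rational.Unnormalised.Base as ℚᵘ using (mkℚᵘ; *≤*)
import Data.Rational.Unnormalised.Properties as ℚᵘ
open import Data.Unit.Polymorphic.Base using (tt)
open import Data.Vec.Base using (Vec) renaming (lookup to lookupᵛ)
open import Function.Base using (id; _∘_)
open import Function.Bundles using (mk⇔; module Equivalence)
open import Level using (0ℓ)
open import Relation.Binary.PropositionalEquality
  using (_≡_; refl; sym; trans; cong; cong₂; subst; subst₂)
open import Relation.Binary.Structures using (IsEquivalence)
open import Relation.Nullary using (Dec; yes; no)
open import Relation.Unary using (Pred; Decidable; _≐_) renaming (_⊆_ to _⊆ᵖ_)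

private
  variable
    A : Set
    N h k m n : ℕ

module ∼ {N k : ℕ} = IsEquivalence (∼-isEquivalence {m = N} {k = k})

-- Counting short subwords.

++-split : ∀ (u : List A) {v x} → Sublist x (u ++ v) →
           ∃[ y ] ∃[ z ] x ≡ y ++ z × Sublist y u × Sublist z v
++-split []      p        = [] , _ , refl , [] , p
++-split (a ∷ u) (_ ∷ʳ p) with ++-split u p
... | y , z , eq , q , r = y , z , eq , a ∷ʳ q , r
++-split (a ∷ u) (refl ∷ p) with ++-split u p
... | y , z , eq , q , r = a ∷ y , z , cong (a ∷_) eq , refl ∷ q , r

module _ {P Q : Pred A 0ℓ} (P? : Decidable P) (Q? : Decidable Q) (P⊆Q : P ⊆ᵖ Q) where

  private
    filter-⊆-filter : ∀ xs → Sublist (filter P? xs) (filter Q? xs)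
    filter-⊆-filter xs = filter⁺ P? Q? (λ { refl → P⊆Q }) (⊆-refl {x = xs})

  length-filter-mono : ∀ xs → length (filter P? xs) ≤ length (filter Q? xs)
  length-filter-mono xs = length-mono-≤ (filter-⊆-filter xs)

  length-filter-≥⇒≡ : ∀ xs → length (filter Q? xs) ≤ length (filter P? xs) →
                      filter P? xs ≡ filter Q? xs
  length-filter-≥⇒≡ xs ge = Pointwise-≡⇒≡
    (toPointwise (≤-antisym (length-filter-mono xs) ge) (filter-⊆-filter xs))

_⊆?_ : (u v : Word N) → Dec (u Subword v)
_⊆?_ = DecSublist._⊆?_ _≟ᶠ_

weight : ℕ → Word N → ℕ
weight {N} h u = length (filter (_⊆? u) (wordsUpTo N h))

weight≤ : ∀ h (u : Word N) → weight h u ≤ length (wordsUpTo N h)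
weight≤ h u = length-filter (_⊆? u) (wordsUpTo _ h)

weight-mono : ∀ h {u v : Word N} → u Subword v → weight h u ≤ weight h v
weight-mono h {u} {v} u⊆v =
  length-filter-mono (_⊆? u) (_⊆? v) (λ x⊆u → ⊆-trans x⊆u u⊆v) (wordsUpTo _ h)

-- The short subwords of `u` form a sublist of those of `v`; once the counts agree, the two lists
-- coincide.
weight-≥⇒∼ : ∀ h {u v : Word N} → u Subword v → weight h v ≤ weight h u → v ∼[ h ] u
weight-≥⇒∼ {N} h {u} {v} u⊆v ge x l = mk⇔
  (λ x⊆v → proj₂ (∈-filter⁻ (_⊆? u) {xs = wordsUpTo N h}
    (subst (x ∈_) (sym same) (∈-filter⁺ (_⊆? v) (∈-wordsUpTo x l) x⊆v))))
  (λ x⊆u → ⊆-trans x⊆u u⊆v)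
  where
  same : filter (_⊆? u) (wordsUpTo N h) ≡ filter (_⊆? v) (wordsUpTo N h)
  same = length-filter-≥⇒≡ (_⊆? u) (_⊆? v) (λ x⊆u → ⊆-trans x⊆u u⊆v) (wordsUpTo N h) ge

length-cartesianProductWith :
  ∀ {A B C : Set} (f : A → B → C) xs ys →
  length (cartesianProductWith f xs ys) ≡ length xs * length ys
length-cartesianProductWith f []       ys = refl
length-cartesianProductWith f (x ∷ xs) ys = trans (length-++ (map (f x) ys))
  (cong₂ _+_ (length-map (f x) ys) (length-cartesianProductWith f xs ys))

length-wordsUpTo : ∀ N h → length (wordsUpTo N h) ≤ suc N ^ h
length-wordsUpTo N zero    = ≤-refl
length-wordsUpTo N (suc h) = begin
  suc (length (cartesianProductWith _∷_ (allFin N) (wordsUpTo N h)))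
    ≡⟨ cong suc (length-cartesianProductWith _∷_ (allFin N) (wordsUpTo N h)) ⟩
  1 + length (allFin N) * length (wordsUpTo N h)
    ≡⟨ cong (λ j → 1 + j * length (wordsUpTo N h)) (length-tabulate {n = N} id) ⟩
  1 + N * length (wordsUpTo N h)
    -- The empty word is paid for by one extra copy of `suc N ^ h`, hence the base `suc N`.
    ≤⟨ +-mono-≤ (m^n>0 (suc N) h) (*-monoʳ-≤ N (length-wordsUpTo N h)) ⟩
  suc N ^ h + N * suc N ^ h
    ∎
  where open ≤-Reasoning

-- Short representatives of `∼[ k ]`-classes.

delete-∼ : ∀ h → k ≤ h + h → (p : Word N) → ∀ {a s} →
           (p ++ [ a ]) ∼[ h ] p → (a ∷ s) ∼[ h ] s →
           (p ++ a ∷ s) ∼[ k ] (p ++ s)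
delete-∼ h k≤2h p {a} {s} pa∼p as∼s x l = mk⇔
  to (λ x⊆ps → ⊆-trans x⊆ps (++⁺ (⊆-refl {x = p}) (a ∷ʳ ⊆-refl)))
  where
  to : x Subword (p ++ a ∷ s) → x Subword (p ++ s)
  to x⊆pas with ++-split p x⊆pas
  ... | y , z , refl , y⊆p , _ ∷ʳ z⊆s = ++⁺ y⊆p z⊆s
  ... | y , _ ∷ z , refl , y⊆p , refl ∷ z⊆s with suc (length y) ≤? h
  -- Here `y ++ [ a ]` is short enough to be found inside `p` alone.
  ... | yes y<h = subst (_Subword (p ++ s)) (++-assoc y [ a ] z)
    (++⁺ (Equivalence.to (pa∼p (y ++ [ a ]) short) (++⁺ y⊆p ⊆-refl)) z⊆s)
    where
    short : length (y ++ [ a ]) ≤ h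
    short = ≤-trans (≤-reflexive (trans (length-++ y) (+-comm (length y) 1))) y<h
  -- Now `y` has at least `h` of the at most `h + h` letters, so `a ∷ z` has at most `h` and is
  -- found inside `s`.
  ... | no y≮h = ++⁺ y⊆p (Equivalence.to (as∼s (a ∷ z) short) (refl ∷ z⊆s))
    where
    short : length (a ∷ z) ≤ h
    short = +-cancelˡ-≤ h _ _ (≤-trans (+-monoˡ-≤ (length (a ∷ z)) (≮⇒≥ y≮h))
      (≤-trans (≤-reflexive (sym (length-++ y))) (≤-trans l k≤2h)))

module _ {k N : ℕ} (h : ℕ) (k≤2h : k ≤ h + h) where

  private
    W : ℕ
    W = length (wordsUpTo N h)

  -- The suffix is shortened behind a prefix p that is already dealt with.  Each
  -- letter kept increases the weight of p or decreases that of the suffix.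
  shorten-after : ∀ (p s : Word N) →
    ∃[ r ] (p ++ s) ∼[ k ] (p ++ r) × length r + weight h p ≤ weight h s + W
  shorten-after p [] = [] , ∼.refl ,
    ≤-trans (weight≤ h p) (m≤n+m W (weight {N} h []))
  shorten-after p (a ∷ s) =
    step (weight h (p ++ [ a ]) ≤? weight h p) (weight h (a ∷ s) ≤? weight h s)
    where
    Result : Set
    Result = ∃[ r ] (p ++ a ∷ s) ∼[ k ] (p ++ r) ×
                    length r + weight h p ≤ weight h (a ∷ s) + W

    p⊆pa : p Subword (p ++ [ a ])
    p⊆pa = ++⁺ʳ [ a ] ⊆-refl

    s⊆as : s Subword (a ∷ s)
    s⊆as = a ∷ʳ ⊆-refl

    keep : weight h p + weight h s < weight h (p ++ [ a ]) + weight h (a ∷ s) → Result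
    keep gain with shorten-after (p ++ [ a ]) s
    ... | r , pas∼par , bound =
      a ∷ r
      , subst₂ (_∼[ k ]_) (++-assoc p [ a ] s) (++-assoc p [ a ] r) pas∼par
      -- Adding `weight h s` to both sides lets the strict `gain` pay for the kept letter without
      -- any subtraction.
      , +-cancelʳ-≤ (weight h s) _ _ (begin
          suc (length r + weight h p) + weight h s
            ≡⟨ cong suc (+-assoc (length r) (weight h p) (weight h s)) ⟩
          suc (length r + (weight h p + weight h s))
            ≤⟨ +-monoʳ-< (length r) gain ⟩
          length r + (weight h (p ++ [ a ]) + weight h (a ∷ s))
            ≡⟨ +-assoc (length r) (weight h (p ++ [ a ])) (weight h (a ∷ s)) ⟨
          length r + weight h (p ++ [ a ]) + weight h (a ∷ s)
            ≤⟨ +-monoˡ-≤ (weight h (a ∷ s)) bound ⟩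
          weight h s + W + weight h (a ∷ s)
            ≡⟨ +-comm (weight h s + W) (weight h (a ∷ s)) ⟩
          weight h (a ∷ s) + (weight h s + W)
            ≡⟨ cong (weight h (a ∷ s) +_) (+-comm (weight h s) W) ⟩
          weight h (a ∷ s) + (W + weight h s)
            ≡⟨ +-assoc (weight h (a ∷ s)) W (weight h s) ⟨
          weight h (a ∷ s) + W + weight h s
            ∎)
      where open ≤-Reasoning

    step : Dec (weight h (p ++ [ a ]) ≤ weight h p) →
           Dec (weight h (a ∷ s) ≤ weight h s) → Result
    step (no p-grows) _ = keep (+-mono-<-≤ (≰⇒> p-grows) (weight-mono h s⊆as))
    step (yes _) (no s-grows) = keep (+-mono-≤-< (weight-mono h p⊆pa) (≰⇒> s-grows))
    step (yes p-same) (yes s-same) with shorten-after p s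
    ... | r , ps∼pr , bound =
      r
      , ∼.trans
          (delete-∼ h k≤2h p (weight-≥⇒∼ h p⊆pa p-same) (weight-≥⇒∼ h s⊆as s-same))
          ps∼pr
      , ≤-trans bound (+-monoˡ-≤ W (weight-mono h s⊆as))

  shorten : ∀ (u : Word N) → ∃[ v ] u ∼[ k ] v × length v ≤ 2 * suc N ^ h
  shorten u with shorten-after [] u
  ... | v , u∼v , bound = v , u∼v , (begin
    length v                       ≤⟨ m≤m+n (length v) (weight {N} h []) ⟩
    length v + weight {N} h []     ≤⟨ bound ⟩
    weight h u + W                 ≤⟨ +-monoˡ-≤ W (weight≤ h u) ⟩
    W + W                          ≤⟨ +-mono-≤ W≤ (≤-trans W≤ (m≤m+n _ 0)) ⟩
    2 * suc N ^ h                  ∎)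
    where
    open ≤-Reasoning
    W≤ : W ≤ suc N ^ h
    W≤ = length-wordsUpTo N h

-- Products in monoids of `J k`.

module _ (M : FiniteMonoid) where
  open FiniteMonoid M using (Carrier; _≈_; _∙_; ε; ∙-cong)
  private module M = FiniteMonoid M

  eval : (A → Carrier) → List A → Carrier
  eval φ u = foldr _∙_ ε (map φ u)

  eval-cong : ∀ {φ ψ : A → Carrier} → (∀ a → φ a ≈ ψ a) → ∀ u → eval φ u ≈ eval ψ u
  eval-cong φ≈ψ []      = M.refl
  eval-cong φ≈ψ (a ∷ u) = ∙-cong (φ≈ψ a) (eval-cong φ≈ψ u)

  -- Quantifying over all valuations `φ` lets the induction over `J k` compose `φ` with morphisms or
  -- lift it along a surjection.
  ∼-Invariant : ℕ → Set
  ∼-Invariant k = ∀ {N} (φ : Fin N → Carrier) {u v} → u ∼[ k ] v → eval φ u ≈ eval φ v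

module _ (M N : FiniteMonoid) where
  private
    module M = FiniteMonoid M
    module N = FiniteMonoid N
  open MonoidMorphisms M.rawMonoid N.rawMonoid

  eval-homo : ∀ {to} → IsMonoidHomomorphism to → (φ : A → M.Carrier) → ∀ u →
              to (eval M φ u) N.≈ eval N (to ∘ φ) u
  eval-homo hom φ []      = IsMonoidHomomorphism.ε-homo hom
  eval-homo hom φ (a ∷ u) = N.trans
    (IsMonoidHomomorphism.homo hom (φ a) (eval M φ u))
    (N.∙-cong N.refl (eval-homo hom φ u))

concatMap-mono : ∀ (φ : A → Word m) {u v} → Sublist u v →
                 concatMap φ u Subword concatMap φ v
concatMap-mono φ []         = []
concatMap-mono φ (a ∷ʳ p)   = ++⁺ (minimum (φ a)) (concatMap-mono φ p)
concatMap-mono φ (refl ∷ p) = ++⁺ ⊆-refl (concatMap-mono φ p)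

-- Keep only the letters of `u` whose block contributes to `x`: each accounts for at least one
-- letter of `x`.
concatMap-source : ∀ (φ : A → Word m) u {x} → x Subword concatMap φ u →
                   ∃[ y ] Sublist y u × length y ≤ length x × x Subword concatMap φ y
concatMap-source φ []      p = [] , [] , z≤n , p
concatMap-source φ (a ∷ u) p with ++-split (φ a) p
... | [] , z , refl , _ , q with concatMap-source φ u q
... | y , y⊆u , l , z⊆y = y , a ∷ʳ y⊆u , l , z⊆y
concatMap-source φ (a ∷ u) p | b ∷ x , z , refl , r , q with concatMap-source φ u q
... | y , y⊆u , l , z⊆y =
  a ∷ y , refl ∷ y⊆u
  , s≤s (≤-trans l (≤-trans (m≤n+m (length z) (length x)) (≤-reflexive (sym (length-++ x)))))
  , ++⁺ r z⊆y

-- In the quotient, `eval` unfolds to `concatMap`. A short subword of the image stems from a subword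
-- of `u` that is no longer, and `v` has that one too.
quotient-∼-invariant : ∀ m → ∼-Invariant (m /∼ k) k
quotient-∼-invariant {k} m {N} φ u∼v x l = mk⇔ (transfer u∼v) (transfer (∼.sym u∼v))
  where
  transfer : ∀ {u v : Word N} → u ∼[ k ] v →
             x Subword concatMap φ u → x Subword concatMap φ v
  transfer {u} u∼v p with concatMap-source φ u p
  ... | y , y⊆u , ly , x⊆y = ⊆-trans x⊆y
    (concatMap-mono φ (Equivalence.to (u∼v y (≤-trans ly l)) y⊆u))

J⇒∼-invariant : ∀ {M} → J k M → ∼-Invariant M k
J⇒∼-invariant (quotient m) = quotient-∼-invariant m
J⇒∼-invariant (submonoid {M} {N} j N↪M) φ {u} {v} u∼v = mono.injective (M.trans
  (eval-homo N M mono.isMonoidHomomorphism φ u) (M.trans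
  (J⇒∼-invariant j (to ∘ φ) u∼v) (M.sym
  (eval-homo N M mono.isMonoidHomomorphism φ v))))
  where
  module M = FiniteMonoid M
  open _↪_ N↪M
  module mono = MonoidMorphisms.IsMonoidMonomorphism isMonomorphism
J⇒∼-invariant emptyProduct φ u∼v = tt
J⇒∼-invariant (product {M} {N} i j) {L} φ {u} {v} u∼v =
  M.trans (proj₁-eval u) (M.trans (J⇒∼-invariant i (proj₁ ∘ φ) u∼v) (M.sym (proj₁-eval v))) ,
  N.trans (proj₂-eval u) (N.trans (J⇒∼-invariant j (proj₂ ∘ φ) u∼v) (N.sym (proj₂-eval v)))
  where
  module M = FiniteMonoid M
  module N = FiniteMonoid N
  module Proj₁ = DirectProduct.Monoid.Proj₁ M.rawMonoid N.rawMonoid M.refl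
  module Proj₂ = DirectProduct.Monoid.Proj₂ M.rawMonoid N.rawMonoid N.refl
  proj₁-eval : ∀ w → proj₁ (eval (M ⊗ N) φ w) M.≈ eval M (proj₁ ∘ φ) w
  proj₁-eval = eval-homo (M ⊗ N) M Proj₁.isMonoidHomomorphism φ
  proj₂-eval : ∀ w → proj₂ (eval (M ⊗ N) φ w) N.≈ eval N (proj₂ ∘ φ) w
  proj₂-eval = eval-homo (M ⊗ N) N Proj₂.isMonoidHomomorphism φ
J⇒∼-invariant (image {M} {N} j M↠N) {L} φ {u} {v} u∼v = N.trans (N.sym (lift u)) (N.trans
  (hom.⟦⟧-cong (J⇒∼-invariant j ψ u∼v)) (lift v))
  where
  module M = FiniteMonoid M
  module N = FiniteMonoid N
  open _↠_ M↠N
  module hom = MonoidMorphisms.IsMonoidHomomorphism isHomomorphism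
  -- Preimages are chosen letter by letter, so both words are lifted by the same valuation.
  ψ : Fin L → M.Carrier
  ψ a = proj₁ (surjective (φ a))
  lift : ∀ w → to (eval M ψ w) N.≈ eval N φ w
  lift w = N.trans (eval-homo M N isHomomorphism ψ w)
    (eval-cong N (λ a → proj₂ (surjective (φ a)) M.refl) w)

-- Programs as words over a finite alphabet of instructions.

^-distribʳ-* : ∀ m n o → (m * n) ^ o ≡ m ^ o * n ^ o
^-distribʳ-* m n zero    = refl
^-distribʳ-* m n (suc o) = trans (cong (m * n *_) (^-distribʳ-* m n o))
  ([m*n]*[o*p]≡[m*o]*[n*p] m n (m ^ o) (n ^ o))

-- The same accepting set `F` serves both programs, because it respects `_≈_`.
run-≈⇒≋ : ∀ {M} (P Q : Program M m n) →
          (∀ w → FiniteMonoid._≈_ M (run P w) (run Q w)) → P ≋ Q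
run-≈⇒≋ {M = M} P Q P≈Q L = mk⇔
  (λ (F , resp , L⊆ , ⊆L) → F , resp ,
    (λ {w} Lw → resp (P≈Q w) (L⊆ Lw)) , (λ {w} Fw → ⊆L (resp (M.sym (P≈Q w)) Fw)))
  (λ (F , resp , L⊆ , ⊆L) → F , resp ,
    (λ {w} Lw → resp (M.sym (P≈Q w)) (L⊆ Lw)) , (λ {w} Fw → ⊆L (resp (P≈Q w) Fw)))
  where module M = FiniteMonoid M

module _ (M : FiniteMonoid) (m : ℕ) where
  open FiniteMonoid M using (Carrier; _≈_; elements; enumeration)
  private module M = FiniteMonoid M

  -- The number of maps from letters to positions in `elements`. It does not depend on `n`, so the
  -- instruction alphabet is linear in `n`.
  outputs : ℕ
  outputs = length elements ^ m

  instruction : Fin n × Fin outputs → Fin n × (Fin m → Carrier)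
  instruction (i , d) = i , lookup elements ∘ finToFun d

  decode : Fin (n * outputs) → Fin n × (Fin m → Carrier)
  decode = instruction ∘ remQuot outputs

  encode : Fin n × (Fin m → Carrier) → Fin (n * outputs)
  encode (i , f) = combine i (funToFin (index ∘ enumeration ∘ f))

  output : Vec (Fin m) n → Fin n × (Fin m → Carrier) → Carrier
  output w (i , f) = f (lookupᵛ w i)

  -- `elements` only meets every class, so encoding preserves outputs up to `_≈_` and not the
  -- instruction itself.
  output-decode-encode : ∀ (w : Vec (Fin m) n) I → output w I ≈ output w (decode (encode I))
  output-decode-encode w (i , f) = begin
    f b
      ≈⟨ lookup-index (enumeration (f b)) ⟩
    lookup elements (position b)
      ≡⟨ cong (lookup elements) (finToFun-funToFin position b) ⟨
    output w (instruction (i , funToFin position))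
      ≡⟨ cong (output w ∘ instruction) (remQuot-combine i (funToFin position)) ⟨
    output w (decode (encode (i , f)))
      ∎
    where
    open import Relation.Binary.Reasoning.Setoid M.setoid
    b : Fin m
    b = lookupᵛ w i
    position : Fin m → Fin (length elements)
    position = index ∘ enumeration ∘ f

  -- The word of instructions is shortened before any input is read. An input `w` is merely a
  -- valuation of the instruction alphabet, so one `Q` works for all inputs.
  shorten-program : ∀ h → J k M → k ≤ h + h → (P : Program M m n) →
                    Σ[ Q ∈ Program M m n ] P ≋ Q × ∣ Q ∣ ≤ 2 * suc (n * outputs) ^ h
  shorten-program {k} {n} h j k≤2h P@(program is)
    with shorten h k≤2h (map encode is)
  ... | v , u∼v , bound = Q , run-≈⇒≋ P Q P≈Q ,
    subst (_≤ 2 * suc (n * outputs) ^ h) (sym (length-map (decode {n}) v)) bound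
    where
    Q : Program M m n
    Q = program (map decode v)
    P≈Q : ∀ w → run P w ≈ run Q w
    P≈Q w = begin
      eval M (output w) is
        ≈⟨ eval-cong M (output-decode-encode w) is ⟩
      eval M (output w ∘ decode ∘ encode) is
        ≡⟨ cong (foldr M._∙_ M.ε) (map-∘ is) ⟩
      eval M (output w ∘ decode) (map encode is)
        ≈⟨ J⇒∼-invariant j (output w ∘ decode) u∼v ⟩
      eval M (output w ∘ decode) v
        ≡⟨ cong (foldr M._∙_ M.ε) (map-∘ v) ⟩
      eval M (output w) (map decode v)
        ∎
      where open import Relation.Binary.Reasoning.Setoid M.setoid

k≤2⌈k/2⌉ : ∀ k → k ≤ ⌈ k /2⌉ + ⌈ k /2⌉
k≤2⌈k/2⌉ k = ≤-trans (≤-reflexive (sym (⌊n/2⌋+⌈n/2⌉≡n k)))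
  (+-monoˡ-≤ ⌈ k /2⌉ (⌊n/2⌋≤⌈n/2⌉ k))

short-programs : ∀ h → k ≤ h + h → ∀ M → J k M → ∀ m →
  Σ[ c ∈ ℕ ] c > 0 × ((n : ℕ) (P : Program M m n) →
    Σ[ Q ∈ Program M m n ] P ≋ Q × ∣ Q ∣ ≤ c * n ^ h)
short-programs h k≤2h M j m =
  -- The constant comes from `suc (n * K) ≤ n * suc K`, valid for positive `n`.
  2 * suc K ^ h , *-mono-≤ {1} {2} (s≤s z≤n) (m^n>0 (suc K) h) , short
  where
  open ≤-Reasoning
  K : ℕ
  K = outputs M m
  short : ∀ n (P : Program M m n) →
          Σ[ Q ∈ Program M m n ] P ≋ Q × ∣ Q ∣ ≤ 2 * suc K ^ h * n ^ h
  -- With no input position there are no instructions, so the program is already empty; the bound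
  -- may be 0 here.
  short zero      P@(program []) = P , (λ _ → mk⇔ id id) , z≤n
  short n@(suc _) P with shorten-program M m h j k≤2h P
  ... | Q , P≋Q , bound = Q , P≋Q , (begin
    ∣ Q ∣                   ≤⟨ bound ⟩
    2 * suc (n * K) ^ h     ≤⟨ *-monoʳ-≤ 2 (^-monoˡ-≤ h (+-monoˡ-≤ (n * K) {1} {n} (s≤s z≤n))) ⟩
    2 * (n + n * K) ^ h     ≡⟨ cong (λ x → 2 * x ^ h) (*-suc n K) ⟨
    2 * (n * suc K) ^ h     ≡⟨ cong (2 *_) (^-distribʳ-* n (suc K) h) ⟩
    2 * (n ^ h * suc K ^ h) ≡⟨ cong (2 *_) (*-comm (n ^ h) (suc K ^ h)) ⟩
    2 * (suc K ^ h * n ^ h) ≡⟨ *-assoc 2 (suc K ^ h) (n ^ h) ⟨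
    2 * suc K ^ h * n ^ h   ∎)

-- Rational growth bounds and the equality of classes.

≤⇒≤· : ∀ {l c s} → l ≤ c * s → l ≤ (ℤ.+ c ℚ./ 1) · s
-- Among unnormalised rationals the denominators stay 1, which reduces the comparison to integers.
≤⇒≤· {l} {c} {s} l≤cs = ℚ.toℚᵘ-cancel-≤ (begin
  ℚ.toℚᵘ (ℤ.+ l ℚ./ 1)
    ≃⟨ ℚ.toℚᵘ-fromℚᵘ (mkℚᵘ (ℤ.+ l) 0) ⟩
  mkℚᵘ (ℤ.+ l) 0
    ≤⟨ *≤* (ℤ.*-monoʳ-≤-nonNeg (ℤ.+ 1) (subst (ℤ.+ l ℤ.≤_) (ℤ.pos-* c s) (ℤ.+≤+ l≤cs))) ⟩
  mkℚᵘ (ℤ.+ c) 0 ℚᵘ.* mkℚᵘ (ℤ.+ s) 0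
    ≃⟨ ℚᵘ.*-cong (ℚ.toℚᵘ-fromℚᵘ (mkℚᵘ (ℤ.+ c) 0)) (ℚ.toℚᵘ-fromℚᵘ (mkℚᵘ (ℤ.+ s) 0)) ⟨
  ℚ.toℚᵘ (ℤ.+ c ℚ./ 1) ℚᵘ.* ℚ.toℚᵘ (ℤ.+ s ℚ./ 1)
    ≃⟨ ℚ.toℚᵘ-homo-* (ℤ.+ c ℚ./ 1) (ℤ.+ s ℚ./ 1) ⟨
  ℚ.toℚᵘ ((ℤ.+ c ℚ./ 1) ℚ.* (ℤ.+ s ℚ./ 1))
    ∎)
  where open ℚᵘ.≤-Reasoning

0<c/1 : ∀ {c} → c > 0 → ℚ.0ℚ ℚ.< (ℤ.+ c ℚ./ 1)
0<c/1 {suc c} _ = ℚ.positive⁻¹ (ℤ.+ suc c ℚ./ 1) {{ℚ.normalize-pos (suc c) 1}}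

proposition3p4 : ((k : ℕ) (M : FiniteMonoid) → J k M → (m : ℕ) →
    Σ[ c ∈ ℕ ] c > 0 ×
    ((n : ℕ) (P : Program M m n) →
    Σ[ Q ∈ Program M m n ] P ≋ Q × ∣ Q ∣ ≤ c * n ^ ⌈ k /2⌉))
    × ((k m : ℕ) →
    𝒫 {m = m} (J k) ≐ 𝒫[ J k , (λ n → n ^ ⌈ k /2⌉) ])
proposition3p4 =
  (λ k → short-programs ⌈ k /2⌉ (k≤2⌈k/2⌉ k)) ,
  (λ k m → (λ {L} → fast k m L) , (⌈ k /2⌉ ,_))
  where
  fast : ∀ k m L → 𝒫 {m = m} (J k) L → 𝒫[ J k , (λ n → n ^ ⌈ k /2⌉) ] L
  fast k m L (_ , M , j , P , P-recognises , _)
    -- The constant `c` is chosen before `n`, so it can serve as `α` for the whole sequence.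
    with short-programs ⌈ k /2⌉ (k≤2⌈k/2⌉ k) M j m
  ... | c , c>0 , short =
    M , j , (λ n → proj₁ (short n (P n))) ,
    (λ n → Equivalence.to (proj₁ (proj₂ (short n (P n))) (slice L n)) (P-recognises n)) ,
    (ℤ.+ c ℚ./ 1) , 0<c/1 c>0 ,
    (λ n → ≤⇒≤· {c = c} {s = n ^ ⌈ k /2⌉} (proj₂ (proj₂ (short n (P n)))))
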